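{- $c_2=1$, $c_3=c_4=\frac12$, $c_5=c_6=\frac25$, $c_7=\frac38$ and $c_8=\frac4{11}$.
   Context: A weighted digraph $D=(V,A,w)$ is a digraph without loops or parallel arcs (opposite arcs allowed) with weights $w:A\to\mathbb{R}_{\ge0}$; $w(D)$ is the total arc weight. For a partition $(X,Y)$ of $V$, $w(X,Y)$ is the total weight of arcs from $X$ to $Y$, and $\mathrm{mac}(D)=\max_{(X,Y)}w(X,Y)$. For an integer $\nu\ge1$, $c_\nu$ is the supremum of reals $c\ge0$ such that every acyclic weighted digraph $D$ whose longest directed path has exactly $\nu$ vertices satisfies $\mathrm{mac}(D)\ge c\cdot w(D)$. -}

module Defs where

open import Algebra.Bundles.Raw using (RawMonoid)
import Algebra.Definitions.RawMonoid as RawMonoidDefs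
open import Data.Bool.Base using (if_then_else_; _∧_)
open import Data.Fin.Base using (Fin)
open import Data.Fin.Subset using (Subset; inside; outside; ∁)
open import Data.List.Base using (List; []; _∷_; _∷ʳ_; length)
open import Data.List.Relation.Unary.Linked using (Linked)
open import Data.List.Relation.Unary.Unique.Propositional using (Unique)
open import Data.Nat.Base as ℕ using (ℕ; zero; suc)
import Data.Nat.Properties as ℕ
open import Data.Product.Base using (_×_; _,_; ∃; ∃₂; Σ-syntax)
open import Data.Rational as ℚ using (ℚ; 0ℚ; 1ℚ; ½)
import Data.Rational.Properties as ℚ
open import Data.Rational.Solver using (module +-*-Solver)
open import Data.Sum.Base using (inj₁; inj₂)
import Data.Vec.Base as Vec
open import Level using (Level; 0ℓ)
open import Relation.Binary.Core using (Rel)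
open import Relation.Binary.Definitions using (Decidable; Irreflexive; Irrelevant)
open import Relation.Binary.PropositionalEquality
  using (_≡_; refl; sym; trans; cong; cong₂; subst)
open import Relation.Nullary.Decidable.Core using (yes; no)
open import Relation.Nullary.Negation.Core using (¬_)

------------------------------------------------------------------------
-- Real numbers: Cauchy sequences of rationals (with a modulus, because
-- the existential is a Σ-type), taken up to _≈_.

Cauchy : (ℕ → ℚ) → Set
Cauchy x = ∀ ε → 0ℚ ℚ.< ε →
  Σ[ N ∈ ℕ ] (∀ m n → N ℕ.≤ m → N ℕ.≤ n → ℚ.∣ x m ℚ.- x n ∣ ℚ.< ε)

record ℝ : Set where
  constructor mkℝ
  field
    seq    : ℕ → ℚ
    cauchy : Cauchy seq

open ℝ public

p≤∣p∣ : ∀ p → p ℚ.≤ ℚ.∣ p ∣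
p≤∣p∣ p with ℚ.≤-total 0ℚ p
... | inj₁ 0≤p = ℚ.≤-reflexive (sym (ℚ.0≤p⇒∣p∣≡p 0≤p))
... | inj₂ p≤0 = ℚ.≤-trans p≤0 (ℚ.0≤∣p∣ p)

∣-∣<⇒< : ∀ {p q ε} → ℚ.∣ p ℚ.- q ∣ ℚ.< ε → p ℚ.< q ℚ.+ ε
∣-∣<⇒< {p} {q} {ε} h = begin-strict
  p                        ≡⟨ solve 2 (λ p q → p := q :+ (p :- q)) refl p q ⟩
  q ℚ.+ (p ℚ.- q)          ≤⟨ ℚ.+-monoʳ-≤ q (p≤∣p∣ (p ℚ.- q)) ⟩
  q ℚ.+ ℚ.∣ p ℚ.- q ∣      <⟨ ℚ.+-monoʳ-< q h ⟩
  q ℚ.+ ε                  ∎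
  where open ℚ.≤-Reasoning
        open +-*-Solver

<⇒-< : ∀ {p q ε} → p ℚ.< q ℚ.+ ε → p ℚ.- q ℚ.< ε
<⇒-< {p} {q} {ε} h = begin-strict
  p ℚ.- q            <⟨ ℚ.+-monoˡ-< (ℚ.- q) h ⟩
  q ℚ.+ ε ℚ.- q      ≡⟨ solve 2 (λ q e → q :+ e :- q := e) refl q ε ⟩
  ε                  ∎
  where open ℚ.≤-Reasoning
        open +-*-Solver

<⇒∣-∣< : ∀ {p q ε} → p ℚ.< q ℚ.+ ε → q ℚ.< p ℚ.+ ε → ℚ.∣ p ℚ.- q ∣ ℚ.< ε
<⇒∣-∣< {p} {q} {ε} h k with ℚ.∣p∣≡p∨∣p∣≡-p (p ℚ.- q)
... | inj₁ eq = subst (ℚ._< ε) (sym eq) (<⇒-< h)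
... | inj₂ eq = subst (ℚ._< ε)
    (sym (trans eq (solve 2 (λ p q → :- (p :- q) := q :- p) refl p q))) (<⇒-< k)
  where open +-*-Solver

0<½ε : ∀ {ε} → 0ℚ ℚ.< ε → 0ℚ ℚ.< ½ ℚ.* ε
0<½ε {ε} 0<ε = subst (ℚ._< ½ ℚ.* ε) (ℚ.*-zeroʳ ½) (ℚ.*-monoʳ-<-pos ½ 0<ε)

⊔-<-ε : ∀ {a b c d ε} → a ℚ.< c ℚ.+ ε → b ℚ.< d ℚ.+ ε → a ℚ.⊔ b ℚ.< (c ℚ.⊔ d) ℚ.+ ε
⊔-<-ε {a} {b} {c} {d} {ε} h k with ℚ.⊔-sel a b
... | inj₁ eq rewrite eq = ℚ.<-≤-trans h (ℚ.+-monoˡ-≤ ε (ℚ.p≤p⊔q c d))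
... | inj₂ eq rewrite eq = ℚ.<-≤-trans k (ℚ.+-monoˡ-≤ ε (ℚ.p≤q⊔p c d))

eventuallyBounded : ∀ x → Cauchy x →
  ∃₂ λ B N → (0ℚ ℚ.< B) × (∀ n → N ℕ.≤ n → ℚ.∣ x n ∣ ℚ.≤ B)
eventuallyBounded x cx with cx 1ℚ (ℚ.positive⁻¹ 1ℚ)
... | N , close = B , N , 0<B , bound
  where
  open ℚ.≤-Reasoning
  open +-*-Solver
  B = 1ℚ ℚ.+ ℚ.∣ x N ∣
  0<B : 0ℚ ℚ.< B
  0<B = ℚ.+-mono-<-≤ (ℚ.positive⁻¹ 1ℚ) (ℚ.0≤∣p∣ (x N))
  bound : ∀ n → N ℕ.≤ n → ℚ.∣ x n ∣ ℚ.≤ B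
  bound n N≤n = begin
    ℚ.∣ x n ∣                          ≡⟨ cong ℚ.∣_∣ (solve 2 (λ p q → p := (p :- q) :+ q) refl (x n) (x N)) ⟩
    ℚ.∣ (x n ℚ.- x N) ℚ.+ x N ∣        ≤⟨ ℚ.∣p+q∣≤∣p∣+∣q∣ (x n ℚ.- x N) (x N) ⟩
    ℚ.∣ x n ℚ.- x N ∣ ℚ.+ ℚ.∣ x N ∣    ≤⟨ ℚ.+-monoˡ-≤ ℚ.∣ x N ∣ (ℚ.<⇒≤ (close n N N≤n ℕ.≤-refl)) ⟩
    1ℚ ℚ.+ ℚ.∣ x N ∣                   ∎

∣*-*∣≤ : ∀ a b c d → ℚ.∣ a ℚ.* b ℚ.- c ℚ.* d ∣ ℚ.≤
         ℚ.∣ a ∣ ℚ.* ℚ.∣ b ℚ.- d ∣ ℚ.+ ℚ.∣ d ∣ ℚ.* ℚ.∣ a ℚ.- c ∣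
∣*-*∣≤ a b c d = begin
  ℚ.∣ a ℚ.* b ℚ.- c ℚ.* d ∣
    ≡⟨ cong ℚ.∣_∣ (solve 4 (λ a b c d → a :* b :- c :* d := a :* (b :- d) :+ d :* (a :- c)) refl a b c d) ⟩
  ℚ.∣ a ℚ.* (b ℚ.- d) ℚ.+ d ℚ.* (a ℚ.- c) ∣
    ≤⟨ ℚ.∣p+q∣≤∣p∣+∣q∣ (a ℚ.* (b ℚ.- d)) (d ℚ.* (a ℚ.- c)) ⟩
  ℚ.∣ a ℚ.* (b ℚ.- d) ∣ ℚ.+ ℚ.∣ d ℚ.* (a ℚ.- c) ∣
    ≡⟨ cong₂ ℚ._+_ (ℚ.∣p*q∣≡∣p∣*∣q∣ a (b ℚ.- d)) (ℚ.∣p*q∣≡∣p∣*∣q∣ d (a ℚ.- c)) ⟩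
  ℚ.∣ a ∣ ℚ.* ℚ.∣ b ℚ.- d ∣ ℚ.+ ℚ.∣ d ∣ ℚ.* ℚ.∣ a ℚ.- c ∣ ∎
  where open ℚ.≤-Reasoning
        open +-*-Solver

*-split : ∀ {ε} B → 0ℚ ℚ.< ε → 0ℚ ℚ.< B → Σ[ δ ∈ ℚ ] (0ℚ ℚ.< δ) × (B ℚ.* δ ≡ ε)
*-split {ε} B 0<ε 0<B = (ℚ.1/ B) ℚ.* ε , 0<δ , eq
  where
  instance
    B-pos : ℚ.Positive B
    B-pos = ℚ.positive 0<B
    B-nz : ℚ.NonZero B
    B-nz = ℚ.pos⇒nonZero B
    ε-pos : ℚ.Positive ε
    ε-pos = ℚ.positive 0<ε
  0<δ : 0ℚ ℚ.< (ℚ.1/ B) ℚ.* ε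
  0<δ = ℚ.positive⁻¹ ((ℚ.1/ B) ℚ.* ε)
          {{ℚ.pos*pos⇒pos (ℚ.1/ B) {{ℚ.1/pos⇒pos B}} ε}}
  eq : B ℚ.* ((ℚ.1/ B) ℚ.* ε) ≡ ε
  eq = trans (sym (ℚ.*-assoc B (ℚ.1/ B) ε))
             (trans (cong (ℚ._* ε) (ℚ.*-inverseʳ B)) (ℚ.*-identityˡ ε))

*-bound : ∀ {a b B δ} → ℚ.∣ a ∣ ℚ.≤ B → ℚ.∣ b ∣ ℚ.< δ → 0ℚ ℚ.< B →
          ℚ.∣ a ∣ ℚ.* ℚ.∣ b ∣ ℚ.< B ℚ.* δ
*-bound {a} {b} {B} {δ} a≤B b<δ 0<B = ℚ.≤-<-trans
  (ℚ.*-monoʳ-≤-nonNeg ℚ.∣ b ∣ {{ℚ.∣-∣-nonNeg b}} a≤B)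
  (ℚ.*-monoʳ-<-pos B {{ℚ.positive 0<B}} b<δ)

*-close : ∀ {a b c d B C δ ε} → 0ℚ ℚ.< B → 0ℚ ℚ.< C → (B ℚ.+ C) ℚ.* δ ≡ ε →
          ℚ.∣ a ∣ ℚ.≤ B → ℚ.∣ d ∣ ℚ.≤ C →
          ℚ.∣ a ℚ.- c ∣ ℚ.< δ → ℚ.∣ b ℚ.- d ∣ ℚ.< δ →
          ℚ.∣ a ℚ.* b ℚ.- c ℚ.* d ∣ ℚ.< ε
*-close {a} {b} {c} {d} {B} {C} {δ} {ε} 0<B 0<C eq a≤B d≤C a-c<δ b-d<δ = begin-strict
  ℚ.∣ a ℚ.* b ℚ.- c ℚ.* d ∣
    ≤⟨ ∣*-*∣≤ a b c d ⟩
  ℚ.∣ a ∣ ℚ.* ℚ.∣ b ℚ.- d ∣ ℚ.+ ℚ.∣ d ∣ ℚ.* ℚ.∣ a ℚ.- c ∣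
    <⟨ ℚ.+-mono-< (*-bound {a} {b ℚ.- d} a≤B b-d<δ 0<B)
                  (*-bound {d} {a ℚ.- c} d≤C a-c<δ 0<C) ⟩
  B ℚ.* δ ℚ.+ C ℚ.* δ
    ≡⟨ ℚ.*-distribʳ-+ δ B C ⟨
  (B ℚ.+ C) ℚ.* δ
    ≡⟨ eq ⟩
  ε ∎
  where open ℚ.≤-Reasoning

⊔-close : ∀ {a b c d ε} →
          ℚ.∣ a ℚ.- c ∣ ℚ.< ε → ℚ.∣ c ℚ.- a ∣ ℚ.< ε →
          ℚ.∣ b ℚ.- d ∣ ℚ.< ε → ℚ.∣ d ℚ.- b ∣ ℚ.< ε →
          ℚ.∣ (a ℚ.⊔ b) ℚ.- (c ℚ.⊔ d) ∣ ℚ.< ε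
⊔-close {a} {b} {c} {d} {ε} ac ca bd db = <⇒∣-∣<
  (⊔-<-ε {a} {b} {c} {d} {ε} (∣-∣<⇒< ac) (∣-∣<⇒< bd))
  (⊔-<-ε {c} {d} {a} {b} {ε} (∣-∣<⇒< ca) (∣-∣<⇒< db))

abstract
  const-cauchy : ∀ q → Cauchy (λ _ → q)
  const-cauchy q ε 0<ε = 0 , λ _ _ _ _ →
    subst (ℚ._< ε) (sym (cong ℚ.∣_∣ (ℚ.+-inverseʳ q))) 0<ε

  +-cauchy : ∀ x y → Cauchy x → Cauchy y → Cauchy (λ n → x n ℚ.+ y n)
  +-cauchy x y cx cy ε 0<ε with cx (½ ℚ.* ε) (0<½ε 0<ε) | cy (½ ℚ.* ε) (0<½ε 0<ε)
  ... | M , hx | N , hy = M ℕ.⊔ N , λ m n l k →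
    let M≤m = ℕ.m⊔n≤o⇒m≤o M N l ; N≤m = ℕ.m⊔n≤o⇒n≤o M N l
        M≤n = ℕ.m⊔n≤o⇒m≤o M N k ; N≤n = ℕ.m⊔n≤o⇒n≤o M N k
    in begin-strict
      ℚ.∣ x m ℚ.+ y m ℚ.- (x n ℚ.+ y n) ∣
        ≡⟨ cong ℚ.∣_∣ (solve 4 (λ a b c d → a :+ b :- (c :+ d) := (a :- c) :+ (b :- d)) refl (x m) (y m) (x n) (y n)) ⟩
      ℚ.∣ (x m ℚ.- x n) ℚ.+ (y m ℚ.- y n) ∣
        ≤⟨ ℚ.∣p+q∣≤∣p∣+∣q∣ (x m ℚ.- x n) (y m ℚ.- y n) ⟩
      ℚ.∣ x m ℚ.- x n ∣ ℚ.+ ℚ.∣ y m ℚ.- y n ∣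
        <⟨ ℚ.+-mono-< (hx m n M≤m M≤n) (hy m n N≤m N≤n) ⟩
      ½ ℚ.* ε ℚ.+ ½ ℚ.* ε
        ≡⟨ ℚ.*-distribʳ-+ ε ½ ½ ⟨
      1ℚ ℚ.* ε
        ≡⟨ ℚ.*-identityˡ ε ⟩
      ε ∎
    where open ℚ.≤-Reasoning
          open +-*-Solver

  *-cauchy : ∀ x y → Cauchy x → Cauchy y → Cauchy (λ n → x n ℚ.* y n)
  *-cauchy x y cx cy ε 0<ε =
    let B , K , 0<B , x≤B = eventuallyBounded x cx
        C , L , 0<C , y≤C = eventuallyBounded y cy
        δ , 0<δ , eq      = *-split (B ℚ.+ C) 0<ε (ℚ.+-mono-< 0<B 0<C)
        M , hx            = cx δ 0<δ
        N , hy            = cy δ 0<δ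
    in (K ℕ.⊔ L) ℕ.⊔ (M ℕ.⊔ N) , λ m n l k →
      let KL≤m = ℕ.m⊔n≤o⇒m≤o (K ℕ.⊔ L) (M ℕ.⊔ N) l
          MN≤m = ℕ.m⊔n≤o⇒n≤o (K ℕ.⊔ L) (M ℕ.⊔ N) l
          KL≤n = ℕ.m⊔n≤o⇒m≤o (K ℕ.⊔ L) (M ℕ.⊔ N) k
          MN≤n = ℕ.m⊔n≤o⇒n≤o (K ℕ.⊔ L) (M ℕ.⊔ N) k
      in *-close {B = B} {C} {δ} 0<B 0<C eq
           (x≤B m (ℕ.m⊔n≤o⇒m≤o K L KL≤m))
           (y≤C n (ℕ.m⊔n≤o⇒n≤o K L KL≤n))
           (hx m n (ℕ.m⊔n≤o⇒m≤o M N MN≤m) (ℕ.m⊔n≤o⇒m≤o M N MN≤n))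
           (hy m n (ℕ.m⊔n≤o⇒n≤o M N MN≤m) (ℕ.m⊔n≤o⇒n≤o M N MN≤n))

  ⊔-cauchy : ∀ x y → Cauchy x → Cauchy y → Cauchy (λ n → x n ℚ.⊔ y n)
  ⊔-cauchy x y cx cy ε 0<ε with cx ε 0<ε | cy ε 0<ε
  ... | M , hx | N , hy = M ℕ.⊔ N , λ m n l k →
    let M≤m = ℕ.m⊔n≤o⇒m≤o M N l ; N≤m = ℕ.m⊔n≤o⇒n≤o M N l
        M≤n = ℕ.m⊔n≤o⇒m≤o M N k ; N≤n = ℕ.m⊔n≤o⇒n≤o M N k
    in ⊔-close {x m} {y m} {x n} {y n} (hx m n M≤m M≤n) (hx n m M≤n M≤m)
                                       (hy m n N≤m N≤n) (hy n m N≤n N≤m)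

infixl 6 _+_ _⊔_
infixl 7 _*_
infix  4 _≤_ _≈_

fromℚ : ℚ → ℝ
fromℚ q = mkℝ (λ _ → q) (const-cauchy q)

0ℝ : ℝ
0ℝ = fromℚ 0ℚ

_+_ _*_ _⊔_ : ℝ → ℝ → ℝ
mkℝ x cx + mkℝ y cy = mkℝ (λ n → x n ℚ.+ y n) (+-cauchy x y cx cy)
mkℝ x cx * mkℝ y cy = mkℝ (λ n → x n ℚ.* y n) (*-cauchy x y cx cy)
mkℝ x cx ⊔ mkℝ y cy = mkℝ (λ n → x n ℚ.⊔ y n) (⊔-cauchy x y cx cy)

-- The slack ε is needed because representatives matter only up to null
-- sequences.
_≤_ : Rel ℝ 0ℓ
x ≤ y = ∀ ε → 0ℚ ℚ.< ε →
  Σ[ N ∈ ℕ ] (∀ n → N ℕ.≤ n → seq x n ℚ.≤ seq y n ℚ.+ ε)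

_≈_ : Rel ℝ 0ℓ
x ≈ y = (x ≤ y) × (y ≤ x)

+-0-rawMonoid : RawMonoid 0ℓ 0ℓ
+-0-rawMonoid = record { Carrier = ℝ ; _≈_ = _≈_ ; _∙_ = _+_ ; ε = 0ℝ }

open RawMonoidDefs +-0-rawMonoid public using (sum)

record IsSupremum {ℓ : Level} (S : ℝ → Set ℓ) (s : ℝ) : Set ℓ where
  field
    upperBound : ∀ c → S c → c ≤ s
    least      : ∀ b → (∀ c → S c → c ≤ b) → s ≤ b

------------------------------------------------------------------------
-- Weighted digraphs

-- Irrelevance of _⟶_ says that there is at most one arc from u to v, i.e.
-- that there are no parallel arcs.
record WeightedDigraph : Set₁ where
  infix 4 _⟶_ _⟶?_
  field
    order      : ℕ
    _⟶_        : Rel (Fin order) 0ℓ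
    _⟶?_       : Decidable _⟶_
    noLoops    : Irreflexive _≡_ _⟶_
    noParallel : Irrelevant _⟶_
    weight     : ∀ {u v} → u ⟶ v → ℝ
    weight≥0   : ∀ {u v} (a : u ⟶ v) → 0ℝ ≤ weight a

  Vertex : Set
  Vertex = Fin order

  arcWeight : Vertex → Vertex → ℝ
  arcWeight u v with u ⟶? v
  ... | yes a = weight a
  ... | no  _ = 0ℝ

  totalWeight : ℝ
  totalWeight = sum λ u → sum λ v → arcWeight u v

  weightBetween : Subset order → Subset order → ℝ
  weightBetween X Y = sum λ u → sum λ v →
    if Vec.lookup X u ∧ Vec.lookup Y v then arcWeight u v else 0ℝ

  IsPath : List Vertex → Set
  IsPath vs = Linked _⟶_ vs × Unique vs

  IsCycle : Vertex → List Vertex → Set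
  IsCycle v vs = Linked _⟶_ ((v ∷ vs) ∷ʳ v) × Unique (v ∷ vs)

  Acyclic : Set
  Acyclic = ∀ v vs → ¬ IsCycle v vs

  LongestPathOrder : ℕ → Set
  LongestPathOrder ν = (∃ λ vs → IsPath vs × length vs ≡ ν)
                     × (∀ vs → IsPath vs → length vs ℕ.≤ ν)

maxOverSubsets : ∀ n → (Subset n → ℝ) → ℝ
maxOverSubsets zero    f = f Vec.[]
maxOverSubsets (suc n) f = maxOverSubsets n (λ X → f (inside Vec.∷ X))
                         ⊔ maxOverSubsets n (λ X → f (outside Vec.∷ X))

-- One of the two parts of the partition (X , ∁ X) may be empty; its weight
-- is then 0.
mac : WeightedDigraph → ℝ
mac D = maxOverSubsets order λ X → weightBetween X (∁ X)
  where open WeightedDigraph D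

CutRatio : ℕ → ℝ → Set₁
CutRatio ν c = (0ℝ ≤ c) ×
  (∀ D → let open WeightedDigraph D in
     Acyclic → LongestPathOrder ν → c * totalWeight ≤ mac D)

-- c_ν = s, with c_ν given by its defining property as a supremum.
infix 4 c[_]≐_
c[_]≐_ : ℕ → ℝ → Set₁
c[ ν ]≐ s = IsSupremum (CutRatio ν) s

{-# OPTIONS --safe #-}
-- The length of a longest walk from a vertex layers an acyclic digraph, with
-- arcs running from higher to lower layers.  Hence a cut of the layers pulls
-- back to a cut of the digraph, and if in a family of K cuts of the ν layers
-- every pair of layers is separated at least p times, averaging over the
-- family gives mac(D) ≥ (p/K) w(D).  Conversely a weighted transitive
-- tournament on ν vertices bounds c_ν from above.  By LP duality the best
-- family and the best tournament give the same bound; for ν ≤ 8 optimal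
-- solutions are exhibited and checked by evaluation.

module Submission where

open import Defs
open import Algebra.Bundles using (CommutativeMonoid)
open import Data.Bool.Base using (Bool; true; false; if_then_else_; _∧_; not)
open import Data.Fin.Base as Fin using (Fin; zero; suc; toℕ; fromℕ<)
import Data.Fin.Properties as Fin
open import Data.Fin.Subset using (Subset; inside; outside; ∁)
open import Data.Fin.Subset.Properties using (anySubset?)
open import Data.Integer.Base using (+_)
open import Data.List.Base using ([]; _∷_; _∷ʳ_; _++_; length; allFin)
open import Data.List.Membership.Propositional using (_∈_)
open import Data.List.Membership.Propositional.Properties using (∈-∃++; ∈-++⁺ʳ)
import Data.List.Properties as List
open import Data.List.Relation.Unary.All as All using (All; []; _∷_)
import Data.List.Relation.Unary.All.Properties as All
open import Data.List.Relation.Unary.AllPairs using ([]; _∷_)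
import Data.List.Relation.Unary.AllPairs.Properties as AllPairs
open import Data.List.Relation.Unary.Any using (here)
open import Data.List.Relation.Unary.Linked using (Linked; []; [-]; _∷_)
open import Data.List.Relation.Unary.Linked.Properties using (AllPairs⇒Linked; Linked⇒AllPairs)
open import Data.List.Relation.Unary.Unique.Propositional using (Unique)
open import Data.List.Relation.Unary.Unique.Propositional.Properties using (allFin⁺)
open import Data.Nat.Base as ℕ using (ℕ; zero; suc; NonZero)
import Data.Nat.Properties as ℕ
open import Data.Product.Base using (_×_; _,_; ∃)
open import Data.Rational as ℚ using (ℚ; 0ℚ; 1ℚ; ½; _/_)
import Data.Rational.Properties as ℚ
open import Data.Rational.Solver using (module +-*-Solver)
open import Data.Sum.Base using (inj₁; inj₂)
open import Data.Unit.Base using (⊤; tt)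
open import Data.Vec.Base as Vec using (Vec; []; _∷_; lookup; tabulate)
import Data.Vec.Properties as Vec
open import Function.Base using (id)
open import Level using (0ℓ)
open import Relation.Binary.Bundles using (Preorder)
open import Relation.Binary.Core using (Rel)
open import Relation.Binary.PropositionalEquality
  using (_≡_; refl; _≢_; ≢-sym; sym; trans; cong; cong₂; subst; subst₂)
import Relation.Binary.Reasoning.Preorder as PreorderReasoning
import Relation.Binary.Reasoning.Setoid as SetoidReasoning
open import Relation.Nullary.Decidable.Core using (Dec; yes; no; from-yes; from-no; _×-dec_; _→-dec_)
open import Relation.Nullary.Negation.Core using (¬_; contradiction)

-- Termwise equality and natural multiples of reals.

-- Finer than _≈_, but a congruence for _*_ without any estimate.
infix 4 _≐_
record _≐_ (x y : ℝ) : Set where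
  constructor termwise
  field term : ∀ n → seq x n ≡ seq y n
open _≐_

≐-refl : ∀ {x} → x ≐ x
≐-refl = termwise λ _ → refl

≐-sym : ∀ {x y} → x ≐ y → y ≐ x
≐-sym x≐y = termwise λ n → sym (term x≐y n)

≐-trans : ∀ {x y z} → x ≐ y → y ≐ z → x ≐ z
≐-trans x≐y y≐z = termwise λ n → trans (term x≐y n) (term y≐z n)

-- `sum` is built from `_+_` and `0ℝ` alone, so the general lemmas on finite sums apply to it with
-- `_≐_` in place of `_≈_`.
+-0-commutativeMonoid : CommutativeMonoid 0ℓ 0ℓ
+-0-commutativeMonoid = record
  { Carrier = ℝ ; _≈_ = _≐_ ; _∙_ = _+_ ; ε = 0ℝ
  ; isCommutativeMonoid = record
    { isMonoid = record
      { isSemigroup = record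
        { isMagma = record
          { isEquivalence = record { refl = ≐-refl ; sym = ≐-sym ; trans = ≐-trans }
          ; ∙-cong = λ x≐y u≐v → termwise λ n → cong₂ ℚ._+_ (term x≐y n) (term u≐v n)
          }
        ; assoc = λ x y z → termwise λ n → ℚ.+-assoc (seq x n) (seq y n) (seq z n)
        }
      ; identity = (λ x → termwise λ n → ℚ.+-identityˡ (seq x n))
                 , (λ x → termwise λ n → ℚ.+-identityʳ (seq x n))
      }
    ; comm = λ x y → termwise λ n → ℚ.+-comm (seq x n) (seq y n)
    }
  }

open CommutativeMonoid +-0-commutativeMonoid
  using (monoid; setoid) renaming (∙-cong to +-cong; identityʳ to +-identityʳ)
open import Algebra.Definitions.RawMonoid ℕ.+-0-rawMonoid using () renaming (sum to sumℕ)
open import Algebra.Properties.CommutativeMonoid.Sum +-0-commutativeMonoid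
  using (∑-comm; sum-cong-≋; sum-replicate)
open import Algebra.Properties.Monoid.Mult monoid
  using (×-homo-+; ×-congʳ) renaming (_×_ to _·_)

1ℝ : ℝ
1ℝ = fromℚ 1ℚ

*-cong : ∀ {x y u v} → x ≐ y → u ≐ v → x * u ≐ y * v
*-cong x≐y u≐v = termwise λ n → cong₂ ℚ._*_ (term x≐y n) (term u≐v n)

·-zero : ∀ k → k · 0ℝ ≐ 0ℝ
·-zero zero    = ≐-refl
·-zero (suc k) = ≐-trans (+-cong (≐-refl {0ℝ}) (·-zero k)) (+-identityʳ 0ℝ)

·-*-assoc : ∀ k x y → k · (x * y) ≐ (k · x) * y
·-*-assoc zero    x y = termwise λ n → sym (ℚ.*-zeroˡ (seq y n))
·-*-assoc (suc k) x y = ≐-trans (+-cong ≐-refl (·-*-assoc k x y))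
  (termwise λ n → sym (ℚ.*-distribʳ-+ (seq y n) (seq x n) (seq (k · x) n)))

·1-* : ∀ k x → (k · 1ℝ) * x ≐ k · x
·1-* k x = ≐-trans (≐-sym (·-*-assoc k 1ℝ x))
  (×-congʳ k (termwise λ n → ℚ.*-identityˡ (seq x n)))

*-·1 : ∀ k x → x * (k · 1ℝ) ≐ k · x
*-·1 k x = ≐-trans (termwise λ n → ℚ.*-comm (seq x n) (seq (k · 1ℝ) n)) (·1-* k x)

-- The order on the reals.

≤-termwise : ∀ x y → (∀ n → seq x n ℚ.≤ seq y n) → x ≤ y
≤-termwise x y x≤y ε 0<ε = 0 , λ n _ → begin
  seq x n            ≤⟨ x≤y n ⟩
  seq y n            ≡⟨ ℚ.+-identityʳ (seq y n) ⟨
  seq y n ℚ.+ 0ℚ     ≤⟨ ℚ.+-monoʳ-≤ (seq y n) (ℚ.<⇒≤ 0<ε) ⟩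
  seq y n ℚ.+ ε      ∎
  where open ℚ.≤-Reasoning

≤-reflexive : ∀ {x y} → x ≐ y → x ≤ y
≤-reflexive {x} {y} x≐y = ≤-termwise x y λ n → ℚ.≤-reflexive (term x≐y n)

≤-refl : ∀ x → x ≤ x
≤-refl x = ≤-reflexive {x} ≐-refl

fromℚ-nonNeg : ∀ q .{{_ : ℚ.NonNegative q}} → 0ℝ ≤ fromℚ q
fromℚ-nonNeg q = ≤-termwise 0ℝ (fromℚ q) λ _ → ℚ.nonNegative⁻¹ q

0≤1ℝ : 0ℝ ≤ 1ℝ
0≤1ℝ = fromℚ-nonNeg 1ℚ

½+½ : ∀ ε → ½ ℚ.* ε ℚ.+ ½ ℚ.* ε ≡ ε
½+½ ε = trans (sym (ℚ.*-distribʳ-+ ε ½ ½)) (ℚ.*-identityˡ ε)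

≤-trans : ∀ x y z → x ≤ y → y ≤ z → x ≤ z
≤-trans x y z x≤y y≤z ε 0<ε
  with M , xy ← x≤y (½ ℚ.* ε) (0<½ε 0<ε) | N , yz ← y≤z (½ ℚ.* ε) (0<½ε 0<ε)
  = M ℕ.⊔ N , λ n M⊔N≤n → begin
  seq x n                               ≤⟨ xy n (ℕ.m⊔n≤o⇒m≤o M N M⊔N≤n) ⟩
  seq y n ℚ.+ ½ ℚ.* ε                   ≤⟨ ℚ.+-monoˡ-≤ (½ ℚ.* ε) (yz n (ℕ.m⊔n≤o⇒n≤o M N M⊔N≤n)) ⟩
  seq z n ℚ.+ ½ ℚ.* ε ℚ.+ ½ ℚ.* ε       ≡⟨ ℚ.+-assoc (seq z n) (½ ℚ.* ε) (½ ℚ.* ε) ⟩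
  seq z n ℚ.+ (½ ℚ.* ε ℚ.+ ½ ℚ.* ε)     ≡⟨ cong (seq z n ℚ.+_) (½+½ ε) ⟩
  seq z n ℚ.+ ε                         ∎
  where open ℚ.≤-Reasoning

≤-preorder : Preorder 0ℓ 0ℓ 0ℓ
≤-preorder = record
  { Carrier = ℝ ; _≈_ = _≐_ ; _≲_ = _≤_
  ; isPreorder = record
    { isEquivalence = CommutativeMonoid.isEquivalence +-0-commutativeMonoid
    ; reflexive     = ≤-reflexive
    ; trans         = λ {x} {y} {z} → ≤-trans x y z
    }
  }

module ≤-Reasoning = PreorderReasoning ≤-preorder

+-mono-≤ : ∀ x y u v → x ≤ y → u ≤ v → x + u ≤ y + v
+-mono-≤ x y u v x≤y u≤v ε 0<ε
  with M , xy ← x≤y (½ ℚ.* ε) (0<½ε 0<ε) | N , uv ← u≤v (½ ℚ.* ε) (0<½ε 0<ε)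
  = M ℕ.⊔ N , λ n M⊔N≤n → begin
  seq x n ℚ.+ seq u n
    ≤⟨ ℚ.+-mono-≤ (xy n (ℕ.m⊔n≤o⇒m≤o M N M⊔N≤n)) (uv n (ℕ.m⊔n≤o⇒n≤o M N M⊔N≤n)) ⟩
  (seq y n ℚ.+ ½ ℚ.* ε) ℚ.+ (seq v n ℚ.+ ½ ℚ.* ε)
    ≡⟨ solve 3 (λ y v e → (y :+ e) :+ (v :+ e) := (y :+ v) :+ (e :+ e)) refl
         (seq y n) (seq v n) (½ ℚ.* ε) ⟩
  (seq y n ℚ.+ seq v n) ℚ.+ (½ ℚ.* ε ℚ.+ ½ ℚ.* ε)
    ≡⟨ cong ((seq y n ℚ.+ seq v n) ℚ.+_) (½+½ ε) ⟩
  seq y n ℚ.+ seq v n ℚ.+ ε ∎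
  where open ℚ.≤-Reasoning
        open +-*-Solver

sum-mono-≤ : ∀ {n} (f g : Fin n → ℝ) → (∀ i → f i ≤ g i) → sum f ≤ sum g
sum-mono-≤ {zero}  f g f≤g = ≤-refl 0ℝ
sum-mono-≤ {suc n} f g f≤g = +-mono-≤ (f zero) (g zero) (sum λ i → f (suc i)) (sum λ i → g (suc i))
  (f≤g zero) (sum-mono-≤ (λ i → f (suc i)) (λ i → g (suc i)) λ i → f≤g (suc i))

x≤x⊔y : ∀ x y → x ≤ x ⊔ y
x≤x⊔y x y = ≤-termwise x (x ⊔ y) λ n → ℚ.p≤p⊔q (seq x n) (seq y n)

y≤x⊔y : ∀ x y → y ≤ x ⊔ y
y≤x⊔y x y = ≤-termwise y (x ⊔ y) λ n → ℚ.p≤q⊔p (seq x n) (seq y n)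

⊔-lub : ∀ x y z → x ≤ z → y ≤ z → x ⊔ y ≤ z
⊔-lub x y z x≤z y≤z ε 0<ε with M , xz ← x≤z ε 0<ε | N , yz ← y≤z ε 0<ε
  = M ℕ.⊔ N , λ n M⊔N≤n →
    ℚ.⊔-lub (xz n (ℕ.m⊔n≤o⇒m≤o M N M⊔N≤n)) (yz n (ℕ.m⊔n≤o⇒n≤o M N M⊔N≤n))

-- One summand passes its gap of `ε` on to the multiple; the gaps of the other summands are
-- discarded.
·-mono-< : ∀ k x y n ε → 0ℚ ℚ.< ε → seq y n ℚ.+ ε ℚ.< seq x n →
           seq (suc k · y) n ℚ.+ ε ℚ.< seq (suc k · x) n
·-mono-< zero x y n ε 0<ε y+ε<x =
  subst₂ ℚ._<_ (cong (ℚ._+ ε) (sym (ℚ.+-identityʳ (seq y n)))) (sym (ℚ.+-identityʳ (seq x n))) y+ε<x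
·-mono-< (suc k) x y n ε 0<ε y+ε<x = begin-strict
  seq y n ℚ.+ seq (suc k · y) n ℚ.+ ε
    ≡⟨ solve 3 (λ y r e → y :+ r :+ e := (y :+ e) :+ r) refl (seq y n) (seq (suc k · y) n) ε ⟩
  (seq y n ℚ.+ ε) ℚ.+ seq (suc k · y) n
    <⟨ ℚ.+-monoˡ-< (seq (suc k · y) n) y+ε<x ⟩
  seq x n ℚ.+ seq (suc k · y) n
    ≡⟨ cong (seq x n ℚ.+_) (ℚ.+-identityʳ (seq (suc k · y) n)) ⟨
  seq x n ℚ.+ (seq (suc k · y) n ℚ.+ 0ℚ)
    ≤⟨ ℚ.+-monoʳ-≤ (seq x n) (ℚ.+-monoʳ-≤ (seq (suc k · y) n) (ℚ.<⇒≤ 0<ε)) ⟩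
  seq x n ℚ.+ (seq (suc k · y) n ℚ.+ ε)
    ≤⟨ ℚ.+-monoʳ-≤ (seq x n) (ℚ.<⇒≤ (·-mono-< k x y n ε 0<ε y+ε<x)) ⟩
  seq x n ℚ.+ seq (suc k · x) n ∎
  where open ℚ.≤-Reasoning
        open +-*-Solver

-- The order of the rationals is decidable, so it is enough to refute a gap above `ε` at an index
-- beyond the threshold for the multiples; `·-mono-<` carries such a gap over to them.
·-cancel-≤ : ∀ k .{{_ : NonZero k}} x y → k · x ≤ k · y → x ≤ y
·-cancel-≤ (suc k) x y kx≤ky ε 0<ε with N , bound ← kx≤ky ε 0<ε
  = N , λ n N≤n → ℚ.≮⇒≥ λ y+ε<x →
    ℚ.<-irrefl refl (ℚ.<-≤-trans (·-mono-< k x y n ε 0<ε y+ε<x) (bound n N≤n))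

·-nonNeg : ∀ k x → 0ℝ ≤ x → 0ℝ ≤ k · x
·-nonNeg zero    x 0≤x = ≤-refl 0ℝ
·-nonNeg (suc k) x 0≤x = +-mono-≤ 0ℝ x 0ℝ (k · x) 0≤x (·-nonNeg k x 0≤x)

·-monoˡ-≤ : ∀ {m n} x → 0ℝ ≤ x → m ℕ.≤ n → m · x ≤ n · x
·-monoˡ-≤ {m} {n} x 0≤x m≤n with k , refl ← ℕ.m≤n⇒∃[o]m+o≡n m≤n = begin
  m · x            ≈⟨ +-identityʳ (m · x) ⟨
  m · x + 0ℝ       ≲⟨ +-mono-≤ (m · x) (m · x) 0ℝ (k · x) (≤-refl (m · x)) (·-nonNeg k x 0≤x) ⟩
  m · x + k · x    ≈⟨ ×-homo-+ x m k ⟨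
  (m ℕ.+ k) · x    ∎
  where open ≤-Reasoning

-- Finite sums of reals.

sum-cong : ∀ {n} (f g : Fin n → ℝ) → (∀ i → f i ≐ g i) → sum f ≐ sum g
sum-cong f g f≐g = sum-cong-≋ {x = f} {y = g} f≐g

-- A multiple is a sum of `k` equal terms, so this is an interchange of two finite sums.
·-distrib-sum : ∀ k {n} (f : Fin n → ℝ) → k · sum f ≐ sum (λ i → k · f i)
·-distrib-sum k {n} f = begin
  k · sum f                            ≈⟨ sum-replicate k ⟨
  sum {k} (λ _ → sum f)                ≈⟨ ∑-comm {k} {n} (λ _ → f) ⟩
  sum (λ i → sum {k} (λ _ → f i))      ≈⟨ sum-cong (λ i → sum {k} λ _ → f i) (λ i → k · f i) (λ _ → sum-replicate k) ⟩
  sum (λ i → k · f i)                  ∎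
  where open SetoidReasoning setoid

sum-distrib-· : ∀ {n} (f : Fin n → ℕ) x → sum (λ i → f i · x) ≐ sumℕ f · x
sum-distrib-· {zero}  f x = ≐-refl
sum-distrib-· {suc n} f x = ≐-trans
  (+-cong ≐-refl (sum-distrib-· (λ i → f (suc i)) x))
  (≐-sym (×-homo-+ x (f zero) (sumℕ λ i → f (suc i))))

-- Maxima over subsets.

maxOverSubsets-upper : ∀ n (f : Subset n → ℝ) X → f X ≤ maxOverSubsets n f
maxOverSubsets-upper zero    f []      = ≤-refl (f [])
maxOverSubsets-upper (suc n) f (b ∷ X) = upper b
  where
  m : Bool → ℝ
  m c = maxOverSubsets n λ Y → f (c ∷ Y)
  below : ∀ c → f (c ∷ X) ≤ m c
  below c = maxOverSubsets-upper n (λ Y → f (c ∷ Y)) X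
  upper : ∀ c → f (c ∷ X) ≤ m inside ⊔ m outside
  upper inside  = ≤-trans (f (inside ∷ X)) (m inside) (m inside ⊔ m outside)
    (below inside) (x≤x⊔y (m inside) (m outside))
  upper outside = ≤-trans (f (outside ∷ X)) (m outside) (m inside ⊔ m outside)
    (below outside) (y≤x⊔y (m inside) (m outside))

maxOverSubsets-least : ∀ n (f : Subset n → ℝ) y → (∀ X → f X ≤ y) → maxOverSubsets n f ≤ y
maxOverSubsets-least zero    f y f≤y = f≤y []
maxOverSubsets-least (suc n) f y f≤y = ⊔-lub (m inside) (m outside) y (least inside) (least outside)
  where
  m : Bool → ℝ
  m c = maxOverSubsets n λ Y → f (c ∷ Y)
  least : ∀ c → m c ≤ y
  least c = maxOverSubsets-least n (λ Y → f (c ∷ Y)) y λ Y → f≤y (c ∷ Y)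

-- Layering an acyclic digraph

module _ {A : Set} where

  unique-until : ∀ {v : A} xs {ys} → Unique (xs ++ v ∷ ys) → All (v ≢_) xs × Unique xs
  unique-until []       _          = [] , []
  unique-until (x ∷ xs) (x∉ ∷ uxs) with v∉xs , uxs′ ← unique-until xs uxs =
    (≢-sym (All.head (All.++⁻ʳ xs x∉)) ∷ v∉xs) , (All.++⁻ˡ xs x∉ ∷ uxs′)

  linked-until : ∀ {R : Rel A 0ℓ} {v} xs {ys} → Linked R (xs ++ v ∷ ys) → Linked R (xs ∷ʳ v)
  linked-until []           _        = [-]
  linked-until (x ∷ [])     (r ∷ _)  = r ∷ [-]
  linked-until (x ∷ y ∷ xs) (r ∷ rs) = r ∷ linked-until (y ∷ xs) rs

module Layering (D : WeightedDigraph) (acyclic : WeightedDigraph.Acyclic D)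
                {ν} (longest : WeightedDigraph.LongestPathOrder D ν) where

  open WeightedDigraph D

  -- In an acyclic digraph walks are paths. The tail has distinct vertices by induction, so cutting
  -- it at a return to `v` would leave a cycle with the distinct vertices that `IsCycle` demands.
  linked⇒unique : ∀ {vs} → Linked _⟶_ vs → Unique vs
  linked⇒unique []  = []
  linked⇒unique [-] = [] ∷ []
  linked⇒unique {v ∷ vs} (v⟶u ∷ walk) = All.¬Any⇒All¬ vs v∉vs ∷ unique
    where
    unique = linked⇒unique walk
    v∉vs : ¬ v ∈ vs
    v∉vs v∈vs with us , _ , eq ← ∈-∃++ v∈vs
      with v∉us , unique-us ← unique-until us (subst Unique eq unique) =
      acyclic v us
        ( linked-until (v ∷ us) (subst (λ vs → Linked _⟶_ (v ∷ vs)) eq (v⟶u ∷ walk))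
        , v∉us ∷ unique-us )

  -- The number counts arcs, one less than the vertices. Without a distinctness condition, existence
  -- is decidable by recursion on the length.
  WalkFrom : ℕ → Vertex → Set
  WalkFrom zero    v = ⊤
  WalkFrom (suc k) v = ∃ λ u → v ⟶ u × WalkFrom k u

  walkFrom? : ∀ k v → Dec (WalkFrom k v)
  walkFrom? zero    v = yes tt
  walkFrom? (suc k) v = Fin.any? λ u → (v ⟶? u) ×-dec walkFrom? k u

  walk⇒linked : ∀ k v → WalkFrom k v → ∃ λ vs → Linked _⟶_ (v ∷ vs) × length vs ≡ k
  walk⇒linked zero    v _ = [] , [-] , refl
  walk⇒linked (suc k) v (u , v⟶u , walk) with vs , linked , eq ← walk⇒linked k u walk =
    u ∷ vs , v⟶u ∷ linked , cong suc eq

  walk<ν : ∀ k v → WalkFrom k v → k ℕ.< ν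
  walk<ν k v walk with vs , linked , refl ← walk⇒linked k v walk =
    let _ , bound = longest in bound (v ∷ vs) (linked , linked⇒unique linked)

  -- The search runs downwards from the bound; the trivial walk justifies the final 0.
  longestWalk≤ : ℕ → Vertex → ℕ
  longestWalk≤ zero    v = 0
  longestWalk≤ (suc k) v with walkFrom? (suc k) v
  ... | yes _ = suc k
  ... | no  _ = longestWalk≤ k v

  longestWalk≤-walk : ∀ k v → WalkFrom (longestWalk≤ k v) v
  longestWalk≤-walk zero    v = tt
  longestWalk≤-walk (suc k) v with walkFrom? (suc k) v
  ... | yes walk = walk
  ... | no  _    = longestWalk≤-walk k v

  longestWalk≤-longest : ∀ k v {j} → j ℕ.≤ k → WalkFrom j v → j ℕ.≤ longestWalk≤ k v
  longestWalk≤-longest zero    v j≤0 _ = j≤0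
  longestWalk≤-longest (suc k) v j≤1+k walk with walkFrom? (suc k) v
  ... | yes _  = j≤1+k
  ... | no ¬walk with ℕ.m≤n⇒m<n∨m≡n j≤1+k
  ...   | inj₁ j<1+k = longestWalk≤-longest k v (ℕ.s≤s⁻¹ j<1+k) walk
  ...   | inj₂ refl  = contradiction walk ¬walk

  height<ν : ∀ v → longestWalk≤ ν v ℕ.< ν
  height<ν v = walk<ν _ v (longestWalk≤-walk ν v)

  -- Every walk has fewer than `ν` arcs, so the search bound `ν` loses nothing and the layer is the
  -- length of a longest walk from `v`.
  layer : Vertex → Fin ν
  layer v = fromℕ< (height<ν v)

  -- Prepending the arc to a longest walk from `v` gives a walk from `u` with one more arc.
  layer-decreasing : ∀ {u v} → u ⟶ v → layer v Fin.< layer u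
  layer-decreasing {u} {v} u⟶v =
    subst₂ ℕ._<_ (sym (Fin.toℕ-fromℕ< (height<ν v))) (sym (Fin.toℕ-fromℕ< (height<ν u)))
      -- The extended walk stays within the search bound by `walk<ν`.
      (longestWalk≤-longest ν u (ℕ.<⇒≤ (walk<ν _ u walk)) walk)
    where
    walk : WalkFrom (suc (longestWalk≤ ν v)) u
    walk = v , u⟶v , longestWalk≤-walk ν v

-- Lower bound: families of cuts of the layers

-- The test in `weightBetween X (∁ X)`, used for layers and for vertices alike.
separates : ∀ {n} → Subset n → Fin n → Fin n → Bool
separates X i j = lookup X i ∧ lookup (∁ X) j

-- The larger index is the tail, since arcs descend through the layers. Cuts count with
-- multiplicity, so a vector can encode a weighted family.
Covers : ∀ {ν K} → ℕ → Vec (Subset ν) K → Set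
Covers p F = ∀ i j → j Fin.< i →
  p ℕ.≤ sumℕ λ k → if separates (lookup F k) i j then 1 else 0

covers? : ∀ {ν K} p (F : Vec (Subset ν) K) → Dec (Covers p F)
covers? p F = Fin.all? λ i → Fin.all? λ j → (j Fin.<? i) →-dec (p ℕ.≤? _)

module CutFamily (D : WeightedDigraph) {ν} (layer : WeightedDigraph.Vertex D → Fin ν)
                 (decreasing : ∀ {u v} → WeightedDigraph._⟶_ D u v → layer v Fin.< layer u)
                 {p K} (F : Vec (Subset ν) K) (covers : Covers p F) where

  open WeightedDigraph D

  preimage : Subset ν → Subset order
  preimage X = tabulate λ v → lookup X (layer v)

  separates-preimage : ∀ X u v → separates X (layer u) (layer v) ≡ separates (preimage X) u v
  separates-preimage X u v = sym (cong₂ _∧_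
    (Vec.lookup∘tabulate _ u)
    (trans (Vec.lookup-map v not (preimage X))
      (trans (cong not (Vec.lookup∘tabulate _ v)) (sym (Vec.lookup-map (layer v) not X)))))

  cutWeight : Fin K → Vertex → Vertex → ℝ
  cutWeight k u v = if separates (preimage (lookup F k)) u v then arcWeight u v else 0ℝ

  separated : Vertex → Vertex → Fin K → ℕ
  separated u v k = if separates (lookup F k) (layer u) (layer v) then 1 else 0

  sum-cutWeight : ∀ u v → sum (λ k → cutWeight k u v) ≐ sumℕ (separated u v) · arcWeight u v
  sum-cutWeight u v = ≐-trans
    (sum-cong (λ k → cutWeight k u v) (λ k → separated u v k · arcWeight u v) each)
    (sum-distrib-· (separated u v) (arcWeight u v))
    where
    indicator : ∀ b x → (if b then x else 0ℝ) ≐ (if b then 1 else 0) · x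
    indicator true  x = ≐-sym (+-identityʳ x)
    indicator false x = ≐-refl
    each : ∀ k → cutWeight k u v ≐ separated u v k · arcWeight u v
    each k rewrite sym (separates-preimage (lookup F k) u v) =
      indicator (separates (lookup F k) (layer u) (layer v)) (arcWeight u v)

  -- On an arc the layers descend, so `covers` applies, and the weight is nonnegative. Off the arcs
  -- both sides vanish.
  covered : ∀ u v → p · arcWeight u v ≤ sum λ k → cutWeight k u v
  covered u v = ≤-trans (p · arcWeight u v) (sumℕ (separated u v) · arcWeight u v)
    (sum λ k → cutWeight k u v) enough (≤-reflexive (≐-sym (sum-cutWeight u v)))
    where
    enough : p · arcWeight u v ≤ sumℕ (separated u v) · arcWeight u v
    enough with u ⟶? v
    ... | yes a = ·-monoˡ-≤ (weight a) (weight≥0 a) (covers (layer u) (layer v) (decreasing a))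
    ... | no  _ = ≤-reflexive (≐-trans (·-zero p) (≐-sym (·-zero (sumℕ (separated u v)))))

  -- Double counting: after the sum over `k` is moved outermost, each inner double sum is the weight
  -- of a pulled-back cut, hence at most `mac D`.
  totalWeight≤mac : p · totalWeight ≤ K · mac D
  totalWeight≤mac = begin
    p · totalWeight
      ≈⟨ ·-distrib-sum p (λ u → sum λ v → arcWeight u v) ⟩
    sum (λ u → p · sum λ v → arcWeight u v)
      ≈⟨ sum-cong (λ u → p · sum (arcWeight u)) (λ u → sum λ v → p · arcWeight u v)
           (λ u → ·-distrib-sum p (arcWeight u)) ⟩
    sum (λ u → sum λ v → p · arcWeight u v)
      ≲⟨ sum-mono-≤ (λ u → sum λ v → p · arcWeight u v) (λ u → sum λ v → sum λ k → cutWeight k u v)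
           (λ u → sum-mono-≤ (λ v → p · arcWeight u v) (λ v → sum λ k → cutWeight k u v) (covered u)) ⟩
    sum (λ u → sum λ v → sum λ k → cutWeight k u v)
      ≈⟨ sum-cong (λ u → sum λ v → sum λ k → cutWeight k u v)
                  (λ u → sum λ k → sum λ v → cutWeight k u v)
           (λ u → ∑-comm {order} {K} λ v k → cutWeight k u v) ⟩
    sum (λ u → sum λ k → sum λ v → cutWeight k u v)
      ≈⟨ ∑-comm {order} {K} (λ u k → sum λ v → cutWeight k u v) ⟩
    sum (λ k → cutOf (preimage (lookup F k)))
      ≲⟨ sum-mono-≤ (λ k → cutOf (preimage (lookup F k))) (λ _ → mac D)
           (λ k → maxOverSubsets-upper order cutOf (preimage (lookup F k))) ⟩
    sum {K} (λ _ → mac D)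
      ≈⟨ sum-replicate K ⟩
    K · mac D ∎
    where
    open ≤-Reasoning
    cutOf : Subset order → ℝ
    cutOf X = weightBetween X (∁ X)

-- The equation says that `s` is `p/K` without dividing reals; the inequality is proved for `K`-fold
-- multiples and `K` is cancelled.
cutRatio-lower : ∀ {ν p K} .{{_ : NonZero K}} (F : Vec (Subset ν) K) → Covers p F →
                 ∀ s → 0ℝ ≤ s → K · s ≐ p · 1ℝ → CutRatio ν s
cutRatio-lower {ν} {p} {K} F covers s 0≤s K·s≐p = 0≤s , λ D acyclic longest →
  let open WeightedDigraph D
      open Layering D acyclic longest
      open CutFamily D layer layer-decreasing F covers
      open ≤-Reasoning
  in ·-cancel-≤ K (s * totalWeight) (mac D) (begin
    K · (s * totalWeight)     ≈⟨ ·-*-assoc K s totalWeight ⟩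
    (K · s) * totalWeight     ≈⟨ *-cong K·s≐p ≐-refl ⟩
    (p · 1ℝ) * totalWeight    ≈⟨ ·1-* p totalWeight ⟩
    p · totalWeight           ≲⟨ totalWeight≤mac ⟩
    K · mac D                 ∎)

-- Upper bound: weighted transitive tournaments

-- Pairs `u < v` with entry 0 are arcs too, so a path through all `n` vertices exists whatever the
-- entries.
tournament : ∀ {n} → Vec (Vec ℕ n) n → WeightedDigraph
tournament {n} m = record
  { order      = n
  ; _⟶_        = Fin._<_
  ; _⟶?_       = Fin._<?_
  ; noLoops    = λ { refl i<i → ℕ.<-irrefl refl i<i }
  ; noParallel = ℕ.<-irrelevant
  ; weight     = λ {u} {v} _ → lookup (lookup m u) v · 1ℝ
  ; weight≥0   = λ {u} {v} _ → ·-nonNeg (lookup (lookup m u) v) 1ℝ 0≤1ℝ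
  }

module Tournament {n} (m : Vec (Vec ℕ n) n) where

  open WeightedDigraph (tournament m)

  acyclic : Acyclic
  -- By transitivity `v` precedes everything after it on the closed walk, including its own second
  -- occurrence.
  acyclic v vs (linked , _) with v<vs ∷ _ ← Linked⇒AllPairs ℕ.<-trans linked =
    ℕ.<-irrefl refl (All.lookup v<vs (∈-++⁺ʳ vs (here refl)))

  -- Each arc raises the index by at least one, and the last index is below `n`.
  increasing-length : ∀ {v vs} → Linked _⟶_ (v ∷ vs) → toℕ v ℕ.+ length (v ∷ vs) ℕ.≤ n
  increasing-length {v} [-] = subst (ℕ._≤ n) (ℕ.+-comm 1 (toℕ v)) (Fin.toℕ<n v)
  increasing-length {v} {u ∷ vs} (v<u ∷ linked) = begin
    toℕ v ℕ.+ suc (length (u ∷ vs))  ≡⟨ ℕ.+-suc (toℕ v) (length (u ∷ vs)) ⟩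
    suc (toℕ v) ℕ.+ length (u ∷ vs)  ≤⟨ ℕ.+-monoˡ-≤ (length (u ∷ vs)) v<u ⟩
    toℕ u ℕ.+ length (u ∷ vs)        ≤⟨ increasing-length linked ⟩
    n                                ∎
    where open ℕ.≤-Reasoning

  longestPath : LongestPathOrder n
  longestPath = (allFin n , (AllPairs⇒Linked (AllPairs.tabulate⁺-< id) , allFin⁺ n) , List.length-tabulate id)
              , λ { []       _            → ℕ.z≤n
                  ; (v ∷ vs) (linked , _) → ℕ.m+n≤o⇒n≤o (toℕ v) (increasing-length linked) }

  -- Counterpart of `arcWeight` in the naturals, where comparisons are decided by evaluation.
  entry : Fin n → Fin n → ℕ
  entry u v with u Fin.<? v
  ... | yes _ = lookup (lookup m u) v
  ... | no  _ = 0

  total : ℕ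
  total = sumℕ λ u → sumℕ λ v → entry u v

  cut : Subset n → ℕ
  cut X = sumℕ λ u → sumℕ λ v → if separates X u v then entry u v else 0

  arcWeight-entry : ∀ u v → arcWeight u v ≐ entry u v · 1ℝ
  arcWeight-entry u v with u Fin.<? v
  ... | yes _ = ≐-refl
  ... | no  _ = ≐-refl

  sum-·1 : ∀ (f : Fin n → Fin n → ℝ) (g : Fin n → Fin n → ℕ) → (∀ u v → f u v ≐ g u v · 1ℝ) →
           sum (λ u → sum (f u)) ≐ sumℕ (λ u → sumℕ (g u)) · 1ℝ
  sum-·1 f g f≐g = ≐-trans
    (sum-cong (λ u → sum (f u)) (λ u → sumℕ (g u) · 1ℝ) λ u → ≐-trans
      (sum-cong (f u) (λ v → g u v · 1ℝ) (f≐g u))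
      (sum-distrib-· (g u) 1ℝ))
    (sum-distrib-· (λ u → sumℕ (g u)) 1ℝ)

  totalWeight-total : totalWeight ≐ total · 1ℝ
  totalWeight-total = sum-·1 arcWeight entry arcWeight-entry

  weightBetween-cut : ∀ X → weightBetween X (∁ X) ≐ cut X · 1ℝ
  weightBetween-cut X = sum-·1 _ (λ u v → if separates X u v then entry u v else 0) each
    where
    each : ∀ u v → (if separates X u v then arcWeight u v else 0ℝ) ≐
                   (if separates X u v then entry u v else 0) · 1ℝ
    each u v with separates X u v
    ... | true  = arcWeight-entry u v
    ... | false = ≐-refl

  -- The absence of a heavy cut is what an exhaustive search over subsets can certify.
  mac≤ : ∀ M → ¬ (∃ λ X → M ℕ.< cut X) → mac (tournament m) ≤ M · 1ℝ
  mac≤ M no-heavy = maxOverSubsets-least n (λ X → weightBetween X (∁ X)) (M · 1ℝ) λ X →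
    ≤-trans (weightBetween X (∁ X)) (cut X · 1ℝ) (M · 1ℝ)
      (≤-reflexive (weightBetween-cut X))
      (·-monoˡ-≤ 1ℝ 0≤1ℝ (ℕ.≮⇒≥ λ M<cut → no-heavy (X , M<cut)))

  heavyCut? : ∀ M → Dec (∃ λ X → M ℕ.< cut X)
  heavyCut? M = anySubset? λ X → M ℕ.<? cut X

-- The tournament is one of the digraphs that an admissible `c` must serve, so `c` times its total
-- is at most `M`, which is the total times `s`.
cutRatio-upper : ∀ {ν} (m : Vec (Vec ℕ ν) ν) .{{_ : NonZero (Tournament.total m)}} {M} →
                 ¬ (∃ λ X → M ℕ.< Tournament.cut m X) →
                 ∀ s → Tournament.total m · s ≐ M · 1ℝ →
                 ∀ c → CutRatio ν c → c ≤ s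
cutRatio-upper m {M} no-heavy s total·s≐M c (_ , ratio) = ·-cancel-≤ total c s (begin
  total · c            ≈⟨ *-·1 total c ⟨
  c * (total · 1ℝ)     ≈⟨ *-cong (≐-refl {c}) totalWeight-total ⟨
  c * totalWeight      ≲⟨ ratio (tournament m) acyclic longestPath ⟩
  mac (tournament m)   ≲⟨ mac≤ M no-heavy ⟩
  M · 1ℝ               ≈⟨ total·s≐M ⟨
  total · s            ∎)
  where
  open Tournament m
  open WeightedDigraph (tournament m) using (totalWeight)
  open ≤-Reasoning

-- The two equations make the primal value `p/K` and the dual value `M/total` both equal to `q`. The
-- supremum is attained: `q` is itself admissible, hence below every upper bound.
c≐-duality : ∀ {ν p K} .{{_ : NonZero K}} (F : Vec (Subset ν) K) → Covers p F →
             ∀ (m : Vec (Vec ℕ ν) ν) .{{_ : NonZero (Tournament.total m)}} {M} →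
             ¬ (∃ λ X → M ℕ.< Tournament.cut m X) →
             ∀ q .{{_ : ℚ.NonNegative q}} →
             K · fromℚ q ≐ p · 1ℝ → Tournament.total m · fromℚ q ≐ M · 1ℝ → c[ ν ]≐ fromℚ q
c≐-duality F covers m no-heavy q K·q≐p total·q≐M = record
  { upperBound = cutRatio-upper m no-heavy (fromℚ q) total·q≐M
  ; least      = λ b bound →
      bound (fromℚ q) (cutRatio-lower F covers (fromℚ q) (fromℚ-nonNeg q) K·q≐p)
  }

-- Optimal cut families and tournaments

-- Found by the simplex method.  Beware that the families cut the arcs from
-- later to earlier positions, the tournaments have arcs u → v for u < v.

pattern I = inside
pattern O = outside

cuts2 : Vec (Subset 2) 1
cuts2 =
    (O ∷ I ∷ [])
  ∷ []

weights2 : Vec (Vec ℕ 2) 2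
weights2 =
    (0 ∷ 1 ∷ [])
  ∷ (0 ∷ 0 ∷ [])
  ∷ []

cuts3 : Vec (Subset 3) 2
cuts3 =
    (O ∷ O ∷ I ∷ [])
  ∷ (O ∷ I ∷ O ∷ [])
  ∷ []

weights3 : Vec (Vec ℕ 3) 3
weights3 =
    (0 ∷ 1 ∷ 0 ∷ [])
  ∷ (0 ∷ 0 ∷ 1 ∷ [])
  ∷ (0 ∷ 0 ∷ 0 ∷ [])
  ∷ []

cuts4 : Vec (Subset 4) 2
cuts4 =
    (O ∷ O ∷ I ∷ I ∷ [])
  ∷ (O ∷ I ∷ O ∷ I ∷ [])
  ∷ []

-- `weights3` with a last vertex whose arcs have weight 0; `weights6` arises from `weights5` in the
-- same way.
weights4 : Vec (Vec ℕ 4) 4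
weights4 =
    (0 ∷ 1 ∷ 0 ∷ 0 ∷ [])
  ∷ (0 ∷ 0 ∷ 1 ∷ 0 ∷ [])
  ∷ (0 ∷ 0 ∷ 0 ∷ 0 ∷ [])
  ∷ (0 ∷ 0 ∷ 0 ∷ 0 ∷ [])
  ∷ []

cuts5 : Vec (Subset 5) 5
cuts5 =
    (O ∷ I ∷ O ∷ I ∷ O ∷ [])
  ∷ (O ∷ O ∷ O ∷ I ∷ I ∷ [])
  ∷ (O ∷ O ∷ I ∷ I ∷ O ∷ [])
  ∷ (O ∷ O ∷ I ∷ O ∷ I ∷ [])
  ∷ (O ∷ I ∷ O ∷ O ∷ I ∷ [])
  ∷ []

weights5 : Vec (Vec ℕ 5) 5
weights5 =
    (0 ∷ 1 ∷ 0 ∷ 0 ∷ 0 ∷ [])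
  ∷ (0 ∷ 0 ∷ 1 ∷ 1 ∷ 0 ∷ [])
  ∷ (0 ∷ 0 ∷ 0 ∷ 1 ∷ 0 ∷ [])
  ∷ (0 ∷ 0 ∷ 0 ∷ 0 ∷ 1 ∷ [])
  ∷ (0 ∷ 0 ∷ 0 ∷ 0 ∷ 0 ∷ [])
  ∷ []

cuts6 : Vec (Subset 6) 5
cuts6 =
    (O ∷ I ∷ O ∷ O ∷ I ∷ I ∷ [])
  ∷ (O ∷ I ∷ O ∷ I ∷ O ∷ I ∷ [])
  ∷ (O ∷ O ∷ I ∷ I ∷ O ∷ I ∷ [])
  ∷ (O ∷ O ∷ I ∷ O ∷ I ∷ I ∷ [])
  ∷ (O ∷ O ∷ O ∷ I ∷ I ∷ O ∷ [])
  ∷ []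

weights6 : Vec (Vec ℕ 6) 6
weights6 =
    (0 ∷ 1 ∷ 0 ∷ 0 ∷ 0 ∷ 0 ∷ [])
  ∷ (0 ∷ 0 ∷ 1 ∷ 1 ∷ 0 ∷ 0 ∷ [])
  ∷ (0 ∷ 0 ∷ 0 ∷ 1 ∷ 0 ∷ 0 ∷ [])
  ∷ (0 ∷ 0 ∷ 0 ∷ 0 ∷ 1 ∷ 0 ∷ [])
  ∷ (0 ∷ 0 ∷ 0 ∷ 0 ∷ 0 ∷ 0 ∷ [])
  ∷ (0 ∷ 0 ∷ 0 ∷ 0 ∷ 0 ∷ 0 ∷ [])
  ∷ []

cuts7 : Vec (Subset 7) 8
cuts7 =
    (O ∷ O ∷ I ∷ O ∷ O ∷ I ∷ I ∷ [])
  ∷ (O ∷ I ∷ O ∷ O ∷ I ∷ I ∷ O ∷ [])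
  ∷ (O ∷ O ∷ O ∷ I ∷ I ∷ O ∷ I ∷ [])
  ∷ (O ∷ O ∷ O ∷ I ∷ O ∷ I ∷ I ∷ [])
  ∷ (O ∷ O ∷ I ∷ O ∷ I ∷ I ∷ I ∷ [])
  ∷ (O ∷ I ∷ O ∷ O ∷ I ∷ O ∷ I ∷ [])
  ∷ (O ∷ O ∷ I ∷ I ∷ I ∷ O ∷ I ∷ [])
  ∷ (O ∷ I ∷ O ∷ I ∷ O ∷ I ∷ I ∷ [])
  ∷ []

weights7 : Vec (Vec ℕ 7) 7
weights7 =
    (0 ∷ 2 ∷ 0 ∷ 0 ∷ 0 ∷ 0 ∷ 0 ∷ [])
  ∷ (0 ∷ 0 ∷ 2 ∷ 1 ∷ 1 ∷ 1 ∷ 0 ∷ [])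
  ∷ (0 ∷ 0 ∷ 0 ∷ 1 ∷ 1 ∷ 1 ∷ 0 ∷ [])
  ∷ (0 ∷ 0 ∷ 0 ∷ 0 ∷ 1 ∷ 1 ∷ 0 ∷ [])
  ∷ (0 ∷ 0 ∷ 0 ∷ 0 ∷ 0 ∷ 2 ∷ 0 ∷ [])
  ∷ (0 ∷ 0 ∷ 0 ∷ 0 ∷ 0 ∷ 0 ∷ 2 ∷ [])
  ∷ (0 ∷ 0 ∷ 0 ∷ 0 ∷ 0 ∷ 0 ∷ 0 ∷ [])
  ∷ []

singles8 : Vec (Subset 8) 10
singles8 =
    (O ∷ O ∷ O ∷ I ∷ O ∷ I ∷ O ∷ I ∷ [])
  ∷ (O ∷ O ∷ O ∷ I ∷ O ∷ I ∷ I ∷ I ∷ [])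
  ∷ (O ∷ O ∷ O ∷ I ∷ I ∷ O ∷ O ∷ I ∷ [])
  ∷ (O ∷ O ∷ O ∷ I ∷ I ∷ I ∷ O ∷ I ∷ [])
  ∷ (O ∷ O ∷ I ∷ I ∷ O ∷ I ∷ I ∷ I ∷ [])
  ∷ (O ∷ O ∷ O ∷ I ∷ I ∷ O ∷ I ∷ O ∷ [])
  ∷ (O ∷ O ∷ I ∷ I ∷ O ∷ O ∷ I ∷ I ∷ [])
  ∷ (O ∷ I ∷ O ∷ I ∷ O ∷ I ∷ O ∷ I ∷ [])
  ∷ (O ∷ O ∷ O ∷ I ∷ I ∷ O ∷ I ∷ I ∷ [])
  ∷ (O ∷ I ∷ O ∷ I ∷ O ∷ O ∷ I ∷ I ∷ [])
  ∷ []

doubles8 : Vec (Subset 8) 6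
doubles8 =
    (O ∷ O ∷ I ∷ O ∷ O ∷ I ∷ I ∷ I ∷ [])
  ∷ (O ∷ I ∷ O ∷ O ∷ I ∷ I ∷ O ∷ I ∷ [])
  ∷ (O ∷ I ∷ O ∷ O ∷ I ∷ O ∷ I ∷ I ∷ [])
  ∷ (O ∷ O ∷ I ∷ O ∷ I ∷ I ∷ O ∷ I ∷ [])
  ∷ (O ∷ O ∷ I ∷ O ∷ I ∷ O ∷ I ∷ I ∷ [])
  ∷ (O ∷ I ∷ O ∷ O ∷ O ∷ I ∷ I ∷ O ∷ [])
  ∷ []

-- The weights in this family are 1/22 and 2/22; listing a cut twice encodes the latter.
cuts8 : Vec (Subset 8) 22
cuts8 = singles8 Vec.++ doubles8 Vec.++ doubles8

weights8 : Vec (Vec ℕ 8) 8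
weights8 =
    (0 ∷ 4 ∷ 0 ∷ 0 ∷ 0 ∷ 0 ∷ 0 ∷ 0 ∷ [])
  ∷ (0 ∷ 0 ∷ 4 ∷ 4 ∷ 1 ∷ 0 ∷ 0 ∷ 0 ∷ [])
  ∷ (0 ∷ 0 ∷ 0 ∷ 4 ∷ 1 ∷ 0 ∷ 0 ∷ 0 ∷ [])
  ∷ (0 ∷ 0 ∷ 0 ∷ 0 ∷ 3 ∷ 2 ∷ 2 ∷ 0 ∷ [])
  ∷ (0 ∷ 0 ∷ 0 ∷ 0 ∷ 0 ∷ 2 ∷ 2 ∷ 0 ∷ [])
  ∷ (0 ∷ 0 ∷ 0 ∷ 0 ∷ 0 ∷ 0 ∷ 2 ∷ 0 ∷ [])
  ∷ (0 ∷ 0 ∷ 0 ∷ 0 ∷ 0 ∷ 0 ∷ 0 ∷ 2 ∷ [])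
  ∷ (0 ∷ 0 ∷ 0 ∷ 0 ∷ 0 ∷ 0 ∷ 0 ∷ 0 ∷ [])
  ∷ []

theoremA : (c[ 2 ]≐ fromℚ (+ 1 / 1))
    × (c[ 3 ]≐ fromℚ (+ 1 / 2)) × (c[ 4 ]≐ fromℚ (+ 1 / 2))
    × (c[ 5 ]≐ fromℚ (+ 2 / 5)) × (c[ 6 ]≐ fromℚ (+ 2 / 5))
    × (c[ 7 ]≐ fromℚ (+ 3 / 8))
    × (c[ 8 ]≐ fromℚ (+ 4 / 11))
theoremA =
    c≐-duality cuts2 (from-yes (covers? 1 cuts2))
      weights2 (from-no (Tournament.heavyCut? weights2 1))
      (+ 1 / 1) (termwise λ _ → refl) (termwise λ _ → refl)
  , c≐-duality cuts3 (from-yes (covers? 1 cuts3))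
      weights3 (from-no (Tournament.heavyCut? weights3 1))
      (+ 1 / 2) (termwise λ _ → refl) (termwise λ _ → refl)
  , c≐-duality cuts4 (from-yes (covers? 1 cuts4))
      weights4 (from-no (Tournament.heavyCut? weights4 1))
      (+ 1 / 2) (termwise λ _ → refl) (termwise λ _ → refl)
  , c≐-duality cuts5 (from-yes (covers? 2 cuts5))
      weights5 (from-no (Tournament.heavyCut? weights5 2))
      (+ 2 / 5) (termwise λ _ → refl) (termwise λ _ → refl)
  , c≐-duality cuts6 (from-yes (covers? 2 cuts6))
      weights6 (from-no (Tournament.heavyCut? weights6 2))
      (+ 2 / 5) (termwise λ _ → refl) (termwise λ _ → refl)
  , c≐-duality cuts7 (from-yes (covers? 3 cuts7))
      -- The entries sum to 16, and 6/16 = 3/8.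
      weights7 (from-no (Tournament.heavyCut? weights7 6))
      (+ 3 / 8) (termwise λ _ → refl) (termwise λ _ → refl)
  -- Here 8/22 = 4/11 from the cuts meets 12/33 from the tournament, whose entries sum to 33.
  , c≐-duality cuts8 (from-yes (covers? 8 cuts8))
      weights8 (from-no (Tournament.heavyCut? weights8 12))
      (+ 4 / 11) (termwise λ _ → refl) (termwise λ _ → refl)
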